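{- Let $\mathcal{C}$ be a permutation class, and let $\mathcal{C}^{+1}$ be the class of its one-point extensions. Then $\mathcal{C}$ is labelled well-quasi-ordered (lwqo) if and only if $\mathcal{C}^{+1}$ is lwqo.
   Context: A permutation of length $n$ is an arrangement $\pi=\pi(1)\cdots\pi(n)$ of $1,\dots,n$ (the empty permutation is allowed). The permutation $\sigma$ of length $k$ is contained in $\pi$ of length $n$, written $\sigma\le\pi$, if there are indices $1\le i_1<\cdots<i_k\le n$ such that $\pi(i_1)\cdots\pi(i_k)$ is order isomorphic to $\sigma$. A permutation class is a set of permutations closed downward under containment. For a class $\mathcal{C}$, $\mathcal{C}^{+1}$ is the set of all permutations $\pi$ from which one can remove at most one entry (and then reduce the remaining entries to the permutation order isomorphic to them) so as to obtain a member of $\mathcal{C}$; it is a permutation class containing $\mathcal{C}$. A quasi-order $(Y,\le)$ is well-quasi-ordered (wqo) if every infinite sequence $y_1,y_2,\dots$ in $Y$ has indices $i<j$ with $y_i\le y_j$. Given a quasi-order $(L,\le_L)$, an $L$-labelled permutation is a pair $(\pi,\ell_\pi)$ with $\pi$ a permutation of length $n$ and $\ell_\pi:\{1,\dots,n\}\to L$. We say $(\sigma,\ell_\sigma)\le(\pi,\ell_\pi)$, where $\sigma$ and $\pi$ have lengths $k$ and $n$, if there are indices $1\le i_1<\cdots<i_k\le n$ such that $\pi(i_1)\cdots\pi(i_k)$ is order isomorphic to $\sigma$ and $\ell_\sigma(j)\le_L\ell_\pi(i_j)$ for all $1\le j\le k$. For a set $X$ of permutations, $X\wr L$ is the set of all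 $L$-labelled members of $X$ under this order. The set $X$ is labelled well-quasi-ordered (lwqo) if $X\wr L$ is wqo for every wqo $(L,\le_L)$. -}

module Defs where

open import Level using (Level; suc; _⊔_)
open import Data.Nat.Base as ℕ using (ℕ)
open import Data.Fin.Base using (Fin; _<_)
open import Data.Fin.Permutation using (Permutation′; _⟨$⟩ʳ_; remove)
open import Data.Product.Base using (Σ; ∃; ∃-syntax; _×_; _,_; proj₁; proj₂)
open import Function.Base using (id; _∘_)
open import Function.Bundles using (_⇔_; mk⇔; Equivalence)
open import Relation.Binary.Bundles using (Preorder)
open import Relation.Binary.Core using (_Preserves_⟶_)
open import Relation.Binary.PropositionalEquality using (_≡_; refl; isEquivalence)
open import Relation.Unary using (Pred)

private
  variable
    p a ℓ₁ ℓ₂ : Level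
    k m n : ℕ

Perm : Set
Perm = ∃ Permutation′

-- Positions and values of a permutation of length n are both numbered by
-- Fin n; the value at position i is π ⟨$⟩ʳ i.
record Embedding (σ : Permutation′ k) (π : Permutation′ n) : Set where
  field
    index      : Fin k → Fin n
    increasing : index Preserves _<_ ⟶ _<_
    orderIso   : ∀ i j →
      (σ ⟨$⟩ʳ i < σ ⟨$⟩ʳ j) ⇔ (π ⟨$⟩ʳ index i < π ⟨$⟩ʳ index j)

open Embedding public

_≼_ : Perm → Perm → Set
(_ , σ) ≼ (_ , π) = Embedding σ π

-- A predicate on Perm need not identify bijections that agree pointwise but
-- are not propositionally equal; downward closure forces a class to do so,
-- since such permutations contain each other.
IsClass : Pred Perm p → Set p
IsClass C = ∀ {σ π} → σ ≼ π → C π → C σ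

-- remove i π deletes the entry at position i and standardises what is left.
data _⁺¹ (C : Pred Perm p) : Pred Perm p where
  keep   : {π : Perm} → C π → (C ⁺¹) π
  delete : {π : Permutation′ (ℕ.suc n)} (i : Fin (ℕ.suc n)) →
           C (n , remove i π) → (C ⁺¹) (ℕ.suc n , π)

WQO : Preorder a ℓ₁ ℓ₂ → Set (a ⊔ ℓ₂)
WQO Y = ∀ (y : ℕ → Carrier) → ∃[ i ] ∃[ j ] (i ℕ.< j × y i ≲ y j)
  where open Preorder Y

record Labelled (X : Pred Perm p) (L : Set a) : Set (p ⊔ a) where
  field
    perm   : Perm
    member : X perm
    label  : Fin (proj₁ perm) → L

open Labelled public

≼-refl : {π : Permutation′ n} → Embedding π π
≼-refl .index        = id
≼-refl .increasing   = id
≼-refl .orderIso i j = mk⇔ id id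

≼-trans : {ρ : Permutation′ k} {σ : Permutation′ m} {π : Permutation′ n} →
          Embedding ρ σ → Embedding σ π → Embedding ρ π
≼-trans e f .index        = index f ∘ index e
≼-trans e f .increasing   = increasing f ∘ increasing e
≼-trans e f .orderIso i j = mk⇔ (F.to ∘ E.to) (E.from ∘ F.from)
  where
  module E = Equivalence (orderIso e i j)
  module F = Equivalence (orderIso f (index e i) (index e j))

-- The underlying equality of the preorder is propositional equality of
-- labelled permutations; it plays no role in WQO.
_≀_ : Pred Perm p → Preorder a ℓ₁ ℓ₂ → Preorder (p ⊔ a) (p ⊔ a) ℓ₂
X ≀ L = record
  { Carrier    = Labelled X L.Carrier
  ; _≈_        = _≡_
  ; _≲_        = λ s t → Σ (perm s ≼ perm t) λ e →
                         ∀ j → label s j L.≲ label t (index e j)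
  ; isPreorder = record
    { isEquivalence = isEquivalence
    ; reflexive     = λ { refl → ≼-refl , λ _ → L.refl }
    ; trans         = λ { (e , s≲t) (f , t≲u) →
                          ≼-trans e f , λ j → L.trans (s≲t j) (t≲u (index e j)) }
    }
  }
  where module L = Preorder L

LWQO : ∀ a ℓ₁ ℓ₂ → Pred Perm p → Set (p ⊔ suc (a ⊔ ℓ₁ ⊔ ℓ₂))
LWQO a ℓ₁ ℓ₂ X = (L : Preorder a ℓ₁ ℓ₂) → WQO L → WQO (X ≀ L)

{-# OPTIONS --safe #-}
-- Deleting an entry x from a permutation in C⁺¹ and recording with each
-- remaining entry on which sides of x it lies, horizontally and vertically,
-- loses no information. An embedding of the shortened permutations that
-- respects these two bits extends by sending the deleted entry to the deleted
-- entry. As L × {0,1}² is wqo whenever L is, the entry labels together with the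
-- label of the deleted entry are handled by lwqo of C and closure of wqo under
-- products. A nonempty member of C also belongs to C after deleting any entry,
-- so only the empty permutation, which is contained in everything, is exempt.
module Submission where

open import Defs
open import Level using (Level; _⊔_; Lift; lift; lower)
open import Axiom.ExcludedMiddle using (ExcludedMiddle)
open import Data.Bool.Base using (Bool)
open import Data.Bool.Properties as Bool using (¬-not)
open import Data.Fin.Base using (Fin; zero; suc; _<_; punchIn; punchOut)
open import Data.Fin.Permutation using (Permutation′; _⟨$⟩ʳ_; remove; punchIn-permute)
open import Data.Fin.Properties using (_≟_; _<?_; <-cmp; ≤∧≢⇒<; punchIn-mono-≤; punchIn-cancel-≤; punchIn-punchOut; punchInᵢ≢i)
open import Data.Nat.Base as ℕ using (ℕ; z≤n; s≤s)
import Data.Nat.Properties as ℕ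
open import Data.Product.Base using (Σ; ∃-syntax; _×_; _,_; proj₁; proj₂)
open import Data.Product.Relation.Binary.Pointwise.NonDependent using (×-preorder)
open import Data.Sum.Base using (_⊎_; inj₁; inj₂)
open import Data.Vec.Functional using (insertAt)
open import Data.Vec.Functional.Properties using (insertAt-lookup; insertAt-punchIn)
open import Function.Base using (id; _∘_)
open import Function.Bundles using (_⇔_; mk⇔; Injection; Equivalence)
open import Function.Definitions using (Injective)
open import Function.Properties.Inverse using (↔⇒↣)
open import Relation.Binary.Bundles using (Preorder)
open import Relation.Binary.Core using (Rel)
open import Relation.Binary.Definitions using (Transitive; tri<; tri≈; tri>)
open import Relation.Binary.PropositionalEquality using (_≡_; refl; sym; trans; subst; subst₂)
open import Relation.Binary.PropositionalEquality.Properties using (preorder)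
open import Relation.Nullary using (¬_; Dec; yes; no; contradiction)
open import Relation.Nullary.Decidable using (map′; does; dec-true; decidable-stable)
open import Relation.Unary using (Pred)

private
  variable
    p a b ℓ ℓ₁ ℓ₂ ℓ₃ ℓ₄ : Level
    k l m n : ℕ

-- Ascending subsequences and products of well-quasi-orders.

em-lower : ∀ ℓ → ExcludedMiddle (ℓ ⊔ ℓ₁) → ExcludedMiddle ℓ
em-lower {ℓ₁} ℓ em {P} = map′ lower lift (em {Lift ℓ₁ P})

-- `next` hands over its witnesses, so dependent choice is plain recursion; transitivity then
-- extends `R` from consecutive terms to all pairs.
serial⇒chain : {S : Set a} {R : Rel S ℓ} → Transitive R → S →
               (∀ s → ∃[ t ] R s t) →
               Σ (ℕ → S) λ g → ∀ {i j} → i ℕ.< j → R (g i) (g j)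
serial⇒chain {S = S} {R} R-trans s₀ next = g , λ i<j → chain (ℕ.≤⇒≤′ i<j)
  where
  g : ℕ → S
  g ℕ.zero    = s₀
  g (ℕ.suc i) = proj₁ (next (g i))

  chain : ∀ {i j} → i ℕ.<′ j → R (g i) (g j)
  chain (ℕ.≤′-reflexive refl) = proj₂ (next _)
  chain (ℕ.≤′-step i<j)       = R-trans (chain i<j) (proj₂ (next _))

module _ (em : ExcludedMiddle ℓ₂) (Y : Preorder a ℓ₁ ℓ₂) where
  open Preorder Y using (Carrier; _≲_) renaming (trans to ≲-trans)

  -- A product needs more than one good pair in a coordinate: along an ascending subsequence for the
  -- first factor, any good pair for the second is good for both.
  WQO⇒monotone-subsequence : WQO Y → (y : ℕ → Carrier) →
    Σ (ℕ → ℕ) λ g → ∀ {i j} → i ℕ.< j → g i ℕ.< g j × y (g i) ≲ y (g j)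
  WQO⇒monotone-subsequence wqo y = result em
    where
    Ascends : ℕ → Set ℓ₂
    Ascends i = ∃[ j ] (i ℕ.< j × y i ≲ y j)

    result : Dec (∃[ N ] ∀ i → N ℕ.≤ i → Ascends i) →
             Σ (ℕ → ℕ) λ g → ∀ {i j} → i ℕ.< j → g i ℕ.< g j × y (g i) ≲ y (g j)
    result (yes (N , ascends)) = proj₁ ∘ proj₁ chain , proj₂ chain
      where
      -- Carrying the bound `N ≤ i` in the state lets `ascends` be applied again at each new index.
      chain = serial⇒chain
        {S = ∃[ i ] N ℕ.≤ i}
        {R = λ (i , _) (j , _) → i ℕ.< j × y i ≲ y j}
        (λ (i<j , u) (j<k , v) → ℕ.<-trans i<j j<k , ≲-trans u v)
        (N , ℕ.≤-refl)
        (λ (i , N≤i) → let (j , i<j , u) = ascends i N≤i in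
                       (j , ℕ.≤-trans N≤i (ℕ.<⇒≤ i<j)) , i<j , u)
    -- Otherwise infinitely many terms lie below no later term, and they form
    -- a bad sequence.
    result (no ¬eventually) =
      let i , j , i<j , u = wqo (y ∘ g)
      in contradiction (g j , proj₂ chain i<j , u) (proj₂ (proj₁ chain i))
      where
      later : ∀ N → ∃[ i ] (N ℕ.≤ i × ¬ Ascends i)
      later N = decidable-stable em λ ¬later → ¬eventually
        (N , λ i N≤i → decidable-stable em λ ¬asc → ¬later (i , N≤i , ¬asc))

      chain = serial⇒chain
        {S = ∃[ i ] ¬ Ascends i}
        {R = λ (i , _) (j , _) → i ℕ.< j}
        ℕ.<-trans
        (proj₁ (later 0) , proj₂ (proj₂ (later 0)))
        (λ (i , _) → let (j , i<j , ¬asc) = later (ℕ.suc i) in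
                     (j , ¬asc) , i<j)

      g : ℕ → ℕ
      g = proj₁ ∘ proj₁ chain

WQO-× : {Y : Preorder a ℓ₁ ℓ₂} {Z : Preorder b ℓ₃ ℓ₄} →
        ExcludedMiddle ℓ₂ → WQO Y → WQO Z → WQO (×-preorder Y Z)
WQO-× {Y = Y} em wqoY wqoZ x =
  let g , mono         = WQO⇒monotone-subsequence em Y wqoY (proj₁ ∘ x)
      i , j , i<j , z≲ = wqoZ (proj₂ ∘ x ∘ g)
      gi<gj , y≲       = mono i<j
  in g i , g j , gi<gj , y≲ , z≲

-- Pigeonhole: three Booleans cannot be pairwise distinct. The order is equality, so comparable side
-- labels agree exactly.
WQO-Bool : WQO (preorder Bool)
WQO-Bool y with y 0 Bool.≟ y 1 | y 1 Bool.≟ y 2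
... | yes y₀≡y₁ | _         = 0 , 1 , s≤s z≤n , y₀≡y₁
... | no _      | yes y₁≡y₂ = 1 , 2 , s≤s (s≤s z≤n) , y₁≡y₂
... | no y₀≢y₁  | no y₁≢y₂  =
  0 , 2 , s≤s z≤n , trans (¬-not y₀≢y₁) (sym (¬-not (y₁≢y₂ ∘ sym)))

-- Embeddings and the removal of an entry.

punchIn-mono-< : ∀ (i : Fin (ℕ.suc n)) {x y} → x < y → punchIn i x < punchIn i y
punchIn-mono-< i {x} {y} x<y = ℕ.≰⇒> (ℕ.<⇒≱ x<y ∘ punchIn-cancel-≤ i y x)

punchIn-cancel-< : ∀ (i : Fin (ℕ.suc n)) {x y} → punchIn i x < punchIn i y → x < y
punchIn-cancel-< i {x} {y} x<y = ℕ.≰⇒> (ℕ.<⇒≱ x<y ∘ punchIn-mono-≤ i y x)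

perm-injective : (π : Permutation′ n) → Injective _≡_ _≡_ (π ⟨$⟩ʳ_)
perm-injective π = Injection.injective (↔⇒↣ π)

-- Values of `σ` at distinct positions are comparable, so a map preserving their order also reflects
-- it.
mkEmbedding : {σ : Permutation′ k} {π : Permutation′ n} (h : Fin k → Fin n) →
              (∀ x y → x < y → h x < h y) →
              (∀ x y → σ ⟨$⟩ʳ x < σ ⟨$⟩ʳ y → π ⟨$⟩ʳ h x < π ⟨$⟩ʳ h y) →
              Embedding σ π
mkEmbedding h inc pres .index = h
mkEmbedding h inc pres .increasing = inc _ _
mkEmbedding {σ = σ} {π} h inc pres .orderIso x y = mk⇔ (pres x y) reflects
  where
  reflects : π ⟨$⟩ʳ h x < π ⟨$⟩ʳ h y → σ ⟨$⟩ʳ x < σ ⟨$⟩ʳ y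
  reflects hx<hy with <-cmp (σ ⟨$⟩ʳ x) (σ ⟨$⟩ʳ y)
  ... | tri< σx<σy _ _ = σx<σy
  ... | tri≈ _ σx≡σy _ with refl ← perm-injective σ σx≡σy =
    contradiction hx<hy (ℕ.<-irrefl refl)
  ... | tri> _ _ σy<σx = contradiction hx<hy (ℕ.<-asym (pres y x σy<σx))

module _ (i : Fin (ℕ.suc n)) (π : Permutation′ (ℕ.suc n)) where

  remove-mono-< : ∀ x y → remove i π ⟨$⟩ʳ x < remove i π ⟨$⟩ʳ y →
                  π ⟨$⟩ʳ punchIn i x < π ⟨$⟩ʳ punchIn i y
  remove-mono-< x y = subst₂ _<_ (sym (punchIn-permute π i x)) (sym (punchIn-permute π i y))
                    ∘ punchIn-mono-< (π ⟨$⟩ʳ i)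

  remove-cancel-< : ∀ x y → π ⟨$⟩ʳ punchIn i x < π ⟨$⟩ʳ punchIn i y →
                    remove i π ⟨$⟩ʳ x < remove i π ⟨$⟩ʳ y
  remove-cancel-< x y = punchIn-cancel-< (π ⟨$⟩ʳ i)
                      ∘ subst₂ _<_ (punchIn-permute π i x) (punchIn-permute π i y)

  remove-≼ : Embedding (remove i π) π
  remove-≼ = mkEmbedding (punchIn i) (λ _ _ → punchIn-mono-< i) remove-mono-<

-- Putting the removed entry back.

data PunchView (i : Fin (ℕ.suc n)) : Fin (ℕ.suc n) → Set where
  hole  : PunchView i i
  other : ∀ x → PunchView i (punchIn i x)

punchView : (i x : Fin (ℕ.suc n)) → PunchView i x
punchView i x with i ≟ x
... | yes refl = hole
... | no i≢x   = subst (PunchView i) (punchIn-punchOut i≢x) (other (punchOut i≢x))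

-- Taking `f` to be `id` gives the horizontal side, and taking it to be the value map gives the
-- vertical one.
side : (Fin (ℕ.suc k) → Fin m) → Fin (ℕ.suc k) → Fin k → Bool
side f i x = does (f (punchIn i x) <? f i)

extend : Fin (ℕ.suc k) → Fin (ℕ.suc n) → (Fin k → Fin n) → Fin (ℕ.suc k) → Fin (ℕ.suc n)
extend i j e = insertAt (punchIn j ∘ e) i j

extend-hole : ∀ i j (e : Fin k → Fin n) → extend i j e i ≡ j
extend-hole i j e = insertAt-lookup (punchIn j ∘ e) i j

extend-punchIn : ∀ i j (e : Fin k → Fin n) x →
                 extend i j e (punchIn i x) ≡ punchIn j (e x)
extend-punchIn i j e = insertAt-punchIn (punchIn j ∘ e) i j

does-≡⇒ : {A : Set a} {B : Set b} (A? : Dec A) (B? : Dec B) →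
          does A? ≡ does B? → A → B
does-≡⇒ A? (yes b) _  _ = b
does-≡⇒ A? (no _)  eq x with () ← trans (sym (dec-true A? x)) eq

module _ {f : Fin (ℕ.suc k) → Fin l} {g : Fin (ℕ.suc n) → Fin m}
         (g-injective : Injective _≡_ _≡_ g)
         (i : Fin (ℕ.suc k)) (j : Fin (ℕ.suc n)) (e : Fin k → Fin n)
         (e-mono : ∀ x y → f (punchIn i x) < f (punchIn i y) →
                   g (punchIn j (e x)) < g (punchIn j (e y)))
         (same-side : ∀ x → side f i x ≡ side g j (e x))
  where

  -- Only comparisons with the hole are new, and the sides settle those. Abstract `f` and `g` let
  -- one argument serve both positions and values.
  extend-mono-< : ∀ x y → f x < f y → g (extend i j e x) < g (extend i j e y)
  extend-mono-< x y fx<fy with punchView i x | punchView i y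
  ... | hole    | hole    = contradiction fx<fy (ℕ.<-irrefl refl)
  ... | other x | hole
    rewrite extend-punchIn i j e x | extend-hole i j e =
    does-≡⇒ (f (punchIn i x) <? f i) (g (punchIn j (e x)) <? g j) (same-side x) fx<fy
  ... | hole    | other y
    rewrite extend-punchIn i j e y | extend-hole i j e =
    -- A false bit only says "not below", hence a weak inequality; injectivity of `g` makes it
    -- strict.
    ≤∧≢⇒< (ℕ.≮⇒≥ (ℕ.<-asym fx<fy ∘
                    does-≡⇒ (g (punchIn j (e y)) <? g j) (f (punchIn i y) <? f i)
                            (sym (same-side y))))
           (punchInᵢ≢i j (e y) ∘ sym ∘ g-injective)
  ... | other x | other y
    rewrite extend-punchIn i j e x | extend-punchIn i j e y =
    e-mono x y fx<fy

module _ {σ : Permutation′ (ℕ.suc k)} {π : Permutation′ (ℕ.suc n)}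
         (i : Fin (ℕ.suc k)) (j : Fin (ℕ.suc n))
         (e : Embedding (remove i σ) (remove j π))
         (same-horizontal : ∀ x → side id i x ≡ side id j (index e x))
         (same-vertical : ∀ x → side (σ ⟨$⟩ʳ_) i x ≡ side (π ⟨$⟩ʳ_) j (index e x))
  where

  extend-embedding : Embedding σ π
  extend-embedding = mkEmbedding (extend i j (index e))
    (extend-mono-< id i j (index e)
      (λ _ _ → punchIn-mono-< j ∘ increasing e ∘ punchIn-cancel-< i) same-horizontal)
    (extend-mono-< (perm-injective π) i j (index e)
      (λ x y → remove-mono-< j π _ _
             ∘ Equivalence.to (orderIso e x y)
             ∘ remove-cancel-< i σ x y)
      same-vertical)

-- Encoding by a deleted entry, and the transfer of wqo.

data Marked (C : Pred Perm p) : Perm → Set p where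
  marked : {π : Permutation′ (ℕ.suc n)} (i : Fin (ℕ.suc n)) →
           C (n , remove i π) → Marked C (ℕ.suc n , π)

-- `keep` names no entry, but by downward closure any position can be deleted; `zero` exists as soon
-- as the length is positive.
mark : {C : Pred Perm p} → IsClass C → ∀ {π} → (C ⁺¹) π → proj₁ π ≡ 0 ⊎ Marked C π
mark closed {ℕ.zero  , π} _            = inj₁ refl
mark closed {ℕ.suc n , π} (keep c)     = inj₂ (marked zero (closed (remove-≼ zero π) c))
mark closed {ℕ.suc n , π} (delete i c) = inj₂ (marked i c)

module _ (C : Pred Perm p) (L : Preorder a ℓ₁ ℓ₂) where
  private
    module L = Preorder L
    module C⁺¹≀L = Preorder ((C ⁺¹) ≀ L)

  -- `Bool` lives at level zero, so these labels stay at the levels for which `C` is assumed lwqo.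
  Sided : Preorder a ℓ₁ ℓ₂
  Sided = ×-preorder L (×-preorder (preorder Bool) (preorder Bool))

  Deleted : Preorder (p ⊔ a) (p ⊔ a ⊔ ℓ₁) ℓ₂
  Deleted = ×-preorder L (C ≀ Sided)

  private module Deleted = Preorder Deleted

  encode : ∀ {π} → Marked C π → (Fin (proj₁ π) → L.Carrier) → Deleted.Carrier
  encode (marked {π = π} i c) λπ = λπ i , record
    { perm   = _ , remove i π
    ; member = c
    ; label  = λ x → λπ (punchIn i x) , side id i x , side (π ⟨$⟩ʳ_) i x
    }

  -- The Boolean components of the comparison are the side equalities that `extend-embedding` asks
  -- for; the separate first component compares the labels at the holes.
  encode-reflects-≲ : ∀ s t (u : Marked C (perm s)) (v : Marked C (perm t)) →
    encode u (label s) Deleted.≲ encode v (label t) → s C⁺¹≀L.≲ t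
  encode-reflects-≲ s t (marked i _) (marked j _) (≲-hole , e , ≲-others) =
    extend-embedding i j e (proj₁ ∘ proj₂ ∘ ≲-others) (proj₂ ∘ proj₂ ∘ ≲-others) , labels
    where
    labels : ∀ x → label s x L.≲ label t (extend i j (index e) x)
    labels x with punchView i x
    ... | hole
      rewrite extend-hole i j (index e) = ≲-hole
    ... | other x
      rewrite extend-punchIn i j (index e) x = proj₁ (≲-others x)

  empty-≲ : ∀ s t → proj₁ (perm s) ≡ 0 → s C⁺¹≀L.≲ t
  empty-≲ record { perm = _ , _ } t refl =
    mkEmbedding (λ ()) (λ ()) (λ ()) , λ ()

  WQO-Deleted : ExcludedMiddle ℓ₂ → LWQO a ℓ₁ ℓ₂ C → WQO L → WQO Deleted
  WQO-Deleted em lwqo wqo = WQO-× {Y = L} {Z = C ≀ Sided} em wqo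
    (lwqo Sided (WQO-× {Y = L} {Z = sides} em wqo
      (WQO-× {Y = preorder Bool} {Z = preorder Bool} (em-lower Level.zero em) WQO-Bool WQO-Bool)))
    where sides = ×-preorder (preorder Bool) (preorder Bool)

  WQO-⁺¹ : ExcludedMiddle ℓ₂ → IsClass C → LWQO a ℓ₁ ℓ₂ C → WQO L → WQO ((C ⁺¹) ≀ L)
  -- An empty term lies below its successor, giving a good pair at once; if there is none, every
  -- term can be marked.
  WQO-⁺¹ em closed lwqo wqo y with em-lower Level.zero em {∃[ i ] proj₁ (perm (y i)) ≡ 0}
  ... | yes (i , empty) = i , ℕ.suc i , ℕ.n<1+n i , empty-≲ (y i) (y (ℕ.suc i)) empty
  ... | no ¬empty =
    let i , j , i<j , u = WQO-Deleted em lwqo wqo (λ i → encode (marks i) (label (y i)))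
    in i , j , i<j , encode-reflects-≲ (y i) (y j) (marks i) (marks j) u
    where
    marks : ∀ i → Marked C (perm (y i))
    marks i with mark closed (member (y i))
    ... | inj₁ empty = contradiction (i , empty) ¬empty
    ... | inj₂ m     = m

-- The order on labelled permutations ignores membership proofs, so a good pair carries over
-- unchanged.
WQO-subset : {X Y : Pred Perm p} → (∀ {π} → X π → Y π) →
             (L : Preorder a ℓ₁ ℓ₂) → WQO (Y ≀ L) → WQO (X ≀ L)
WQO-subset X⊆Y L wqo x = wqo λ i → record
  { perm   = perm (x i)
  ; member = X⊆Y (member (x i))
  ; label  = label (x i)
  }

theorem4p5 : ∀ {p a ℓ₁ ℓ₂ : Level} →
    ExcludedMiddle (p ⊔ a ⊔ ℓ₁ ⊔ ℓ₂) →
    (C : Pred Perm p) → IsClass C →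
    LWQO a ℓ₁ ℓ₂ C ⇔ LWQO a ℓ₁ ℓ₂ (C ⁺¹)
theorem4p5 {p} {a} {ℓ₁} {ℓ₂} em C closed = mk⇔
  (λ lwqo L wqo → WQO-⁺¹ C L (em-lower {p ⊔ a ⊔ ℓ₁} ℓ₂ em) closed lwqo wqo)
  (λ lwqo L wqo → WQO-subset keep L (lwqo L wqo))
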